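{- Let $K$ be a field, $R = K[x,y,z]$, $d \ge 1$ an integer, and let $I \subset R$ be any monomial ideal such that the triangular region $T = T_d(I)$ is balanced. Then $T$ is tileable if and only if $T$ has no $\bigtriangledown$-heavy monomial subregions.
   Context: For $d\ge 1$, $\mathcal{T}_d$ is the equilateral triangle of side length $d$ subdivided into equilateral unit triangles. Its downward-pointing unit triangles are labelled bijectively by the monomials of degree $d-2$ in $x,y,z$, and its upward-pointing unit triangles by the monomials of degree $d-1$, with $x^{d-1}$ at the top, $y^{d-1}$ at the bottom-left, $z^{d-1}$ at the bottom-right; a downward-pointing triangle with label $n$ and an upward-pointing triangle with label $m$ share an edge if and only if $m\in\{xn,yn,zn\}$. For a monomial ideal $I$, the triangular region $T_d(I)$ is the set of unit triangles of $\mathcal{T}_d$ whose label is not in $I$. A set of unit triangles is balanced if it contains equally many upward- and downward-pointing triangles, and $\bigtriangledown$-heavy if it contains strictly more downward-pointing than upward-pointing triangles. A lozenge is the union of two unit triangles sharing an edge (necessarily one upward- and one downward-pointing). A region is tileable if it is empty or can be partitioned into lozenges, i.e. there is a set of lozenges contained in the region such that each unit triangle of the region lies in exactly one of them. For a monomial $x^ay^bz^c$ of degree less than $d$, the monomial subregion of $T$ associated to $x^ay^bz^c$ consists of the unit triangles of $T$ whose labels are divisible by $x^ay^bz^c$. -}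

module Defs where

open import Level using (Level; _⊔_; 0ℓ) renaming (suc to lsuc)
open import Algebra.Apartness.Bundles using (HeytingField)
open import Data.Bool.Base using (if_then_else_)
open import Data.List.Base using (List; []; _∷_; _++_; length; cartesianProductWith)
open import Data.List.Membership.Propositional using () renaming (_∈_ to _∈ˡ_)
open import Data.List.Relation.Unary.Unique.Propositional using (Unique)
open import Data.Nat.Base using (ℕ; _+_; _<_)
import Data.Nat.Properties as ℕ
open import Data.Product.Base using (Σ-syntax; ∃-syntax; _×_; _,_)
open import Data.Product using (∃!)
open import Data.Sum.Base using (_⊎_)
open import Function.Bundles using (_⇔_)
open import Relation.Binary.Core using (Rel)
open import Relation.Binary.Definitions using (DecidableEquality)
open import Relation.Binary.PropositionalEquality using (_≡_; refl)
open import Relation.Nullary.Decidable using (does; map′; _×-dec_)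
open import Relation.Unary using (Pred; _∈_; _∉_; _⊆_; _∩_; _≐_; Empty)

private variable
  a i g : Level

------------------------------------------------------------------------
-- Monomials

record Monomial : Set where
  constructor x^_y^_z^_
  field
    xᵉ yᵉ zᵉ : ℕ

open Monomial public

degree : Monomial → ℕ
degree (x^ a y^ b z^ c) = a + b + c

infixl 7 _·_
_·_ : Monomial → Monomial → Monomial
(x^ a y^ b z^ c) · (x^ a′ y^ b′ z^ c′) = x^ (a + a′) y^ (b + b′) z^ (c + c′)

infix 4 _∣ᵐ_
_∣ᵐ_ : Rel Monomial 0ℓ
p ∣ᵐ m = ∃[ q ] m ≡ q · p

x y z : Monomial
x = x^ 1 y^ 0 z^ 0
y = x^ 0 y^ 1 z^ 0
z = x^ 0 y^ 0 z^ 1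

infix 4 _≟ᵐ_
_≟ᵐ_ : DecidableEquality Monomial
(x^ a y^ b z^ c) ≟ᵐ (x^ a′ y^ b′ z^ c′) =
  map′ (λ { (refl , refl , refl) → refl }) (λ { refl → refl , refl , refl })
       (a ℕ.≟ a′ ×-dec b ℕ.≟ b′ ×-dec c ℕ.≟ c′)

------------------------------------------------------------------------
-- The polynomial ring K[x,y,z] and its ideals

module PolynomialRing {k ℓ₁ ℓ₂} (K : HeytingField k ℓ₁ ℓ₂) where
  private module K = HeytingField K

  -- A polynomial is a formal sum of terms; the monomials need not be
  -- distinct nor the coefficients nonzero, so equality is _≈_ below.
  Polynomial : Set k
  Polynomial = List (K.Carrier × Monomial)

  coefficient : Polynomial → Monomial → K.Carrier
  coefficient []            m = K.0#
  coefficient ((c , n) ∷ f) m =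
    if does (n ≟ᵐ m) then c K.+ coefficient f m else coefficient f m

  infix 4 _≈_
  _≈_ : Rel Polynomial ℓ₁
  f ≈ g = ∀ m → coefficient f m K.≈ coefficient g m

  0ᵖ : Polynomial
  0ᵖ = []

  infixl 6 _+ᵖ_
  _+ᵖ_ : Polynomial → Polynomial → Polynomial
  _+ᵖ_ = _++_

  infixl 7 _*ᵖ_
  _*ᵖ_ : Polynomial → Polynomial → Polynomial
  _*ᵖ_ = cartesianProductWith λ { (c , m) (c′ , m′) → (c K.* c′ , m · m′) }

  monomial : Monomial → Polynomial
  monomial m = (K.1# , m) ∷ []

  record IsIdeal (I : Pred Polynomial i) : Set (k ⊔ ℓ₁ ⊔ i) where
    field
      respects-≈ : ∀ {f g} → f ≈ g → f ∈ I → g ∈ I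
      0-closed   : 0ᵖ ∈ I
      +-closed   : ∀ {f g} → f ∈ I → g ∈ I → f +ᵖ g ∈ I
      *-closed   : ∀ r {f} → f ∈ I → r *ᵖ f ∈ I

  data ⟨_⟩ (G : Pred Polynomial g) : Pred Polynomial (k ⊔ ℓ₁ ⊔ g) where
    generator  : ∀ {f} → f ∈ G → f ∈ ⟨ G ⟩
    respects-≈ : ∀ {f g} → f ≈ g → f ∈ ⟨ G ⟩ → g ∈ ⟨ G ⟩
    0-closed   : 0ᵖ ∈ ⟨ G ⟩
    +-closed   : ∀ {f g} → f ∈ ⟨ G ⟩ → g ∈ ⟨ G ⟩ → f +ᵖ g ∈ ⟨ G ⟩
    *-closed   : ∀ r {f} → f ∈ ⟨ G ⟩ → r *ᵖ f ∈ ⟨ G ⟩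

  monomials : Pred Monomial g → Pred Polynomial (k ⊔ g)
  monomials S f = ∃[ m ] m ∈ S × f ≡ monomial m

  record IsMonomialIdeal (I : Pred Polynomial i) : Set (k ⊔ ℓ₁ ⊔ lsuc i) where
    field
      isIdeal     : IsIdeal I
      generators  : Pred Monomial i
      isGenerated : I ≐ ⟨ monomials generators ⟩

------------------------------------------------------------------------
-- Unit triangles and regions

-- Unit triangles are identified with their orientation and label; which
-- of them belong to the subdivided triangle of side length d is
-- determined by the degree of the label.
data UnitTriangle : Set where
  △ ▽ : Monomial → UnitTriangle

label : UnitTriangle → Monomial
label (△ m) = m
label (▽ n) = n

-- d - 1 and d - 2 are not truncated: for d = 1 there is no downward-pointing
-- triangle.
𝒯 : ℕ → Pred UnitTriangle 0ℓ
𝒯 d (△ m) = degree m + 1 ≡ d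
𝒯 d (▽ n) = degree n + 2 ≡ d

Upward Downward : Pred UnitTriangle 0ℓ
Upward   t = ∃[ m ] t ≡ △ m
Downward t = ∃[ n ] t ≡ ▽ n

Region : ∀ i → Set (lsuc i)
Region i = Pred UnitTriangle i

module _ {k ℓ₁ ℓ₂} (K : HeytingField k ℓ₁ ℓ₂) where
  open PolynomialRing K

  T : ℕ → Pred Polynomial i → Region i
  T d I t = t ∈ 𝒯 d × monomial (label t) ∉ I

subregion : Monomial → Region i → Region i
subregion p S t = t ∈ S × p ∣ᵐ label t

------------------------------------------------------------------------
-- Counting

record HasSize {A : Set a} (P : Pred A i) (n : ℕ) : Set (a ⊔ i) where
  field
    elements : List A
    unique   : Unique elements
    exact    : ∀ t → t ∈ˡ elements ⇔ t ∈ P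
    size     : length elements ≡ n

Balanced : Region i → Set i
Balanced S = ∃[ n ] HasSize (S ∩ Upward) n × HasSize (S ∩ Downward) n

▽-Heavy : Region i → Set i
▽-Heavy S = ∃[ u ] ∃[ v ] HasSize (S ∩ Upward) u × HasSize (S ∩ Downward) v × u < v

------------------------------------------------------------------------
-- Tilings

SharesEdge : Monomial → Monomial → Set
SharesEdge n m = m ≡ x · n ⊎ m ≡ y · n ⊎ m ≡ z · n

-- The adjacency proof is irrelevant, so that lozenges are equal as soon as
-- they consist of the same two triangles.
record Lozenge : Set where
  field
    down up     : Monomial
    .sharesEdge : SharesEdge down up

triangles : Lozenge → Pred UnitTriangle 0ℓ
triangles l t = t ≡ ▽ (Lozenge.down l) ⊎ t ≡ △ (Lozenge.up l)

record IsTiling (S : Region i) (L : Pred Lozenge 0ℓ) : Set i where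
  field
    contained : ∀ {l} → l ∈ L → triangles l ⊆ S
    exactly-1 : ∀ {t} → t ∈ S → ∃! _≡_ λ l → l ∈ L × t ∈ triangles l

Tileable : Region i → Set (lsuc 0ℓ ⊔ i)
Tileable S = Empty S ⊎ Σ[ L ∈ Pred Lozenge 0ℓ ] IsTiling S L

{-# OPTIONS --safe #-}
module Submission where

-- A violation of Hall's condition for matching downward to adjacent upward
-- triangles is turned into a ▽-heavy monomial subregion. A finite list ps of
-- monomials selects the triangles whose label is a multiple of some p ∈ ps;
-- neighbourhoods of sets of downward triangles have this form. If two of
-- these monomial triangles p, q have a common upward triangle m₀, replacing
-- them by gcd p q does not lower the excess of ▽ over △: each new upward label
-- m is below m₀ in two coordinates, hence above it in the third, and lowering
-- that third coordinate injects the new △'s into the new ▽'s. Once the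
-- triangles are disjoint, the excess is the sum of the individual excesses,
-- none of which is positive.

open import Algebra.Apartness.Bundles using (HeytingField)
open import Data.Bool.Base using (true; false)
open import Data.List.Base using (List; []; _∷_; _++_; filter; length; map)
open import Data.List.Membership.Propositional using (_∈_; find; lose)
open import Data.List.Membership.Propositional.Properties
  using (∈-∃++; ∈-map⁺; ∈-map⁻; ∈-filter⁺; ∈-filter⁻)
open import Data.List.Properties
  using (filter-accept; filter-reject; length-map; map-∘; map-id-local)
open import Data.List.Relation.Binary.Permutation.Propositional
  using (_↭_; prep; ↭-refl; ↭-sym; ↭-trans; ↭⇒↭ₛ)
open import Data.List.Relation.Binary.Permutation.Propositional.Properties
  using (filter-↭; ↭-length; shift; ∈-resp-↭; Any-resp-↭)
import Data.List.Relation.Binary.Permutation.Setoid.Properties as ↭ₛ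
open import Data.List.Relation.Unary.All using ([]; _∷_)
import Data.List.Relation.Unary.All as All
open import Data.List.Relation.Unary.AllPairs using ([]; _∷_)
open import Data.List.Relation.Unary.Any using (Any; here; there; any?)
import Data.List.Relation.Unary.Any as Any
open import Data.List.Relation.Unary.Unique.Propositional using (Unique)
open import Data.List.Relation.Unary.Unique.Propositional.Properties
  using (filter⁺; map⁺; map⁻)
open import Data.Nat.Base using (ℕ; suc; _+_; _≤_; _<_; _≥_; z≤n; s≤s; _∸_; _⊓_)
import Data.Nat.Properties as ℕ
open import Data.Nat.Solver using (module +-*-Solver)
open import Data.Product using (∃!)
open import Data.Product.Base using (Σ-syntax; ∃; ∃-syntax; _×_; _,_; proj₁; proj₂)
open import Data.Sum.Base using (_⊎_; inj₁; inj₂; [_,_])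
open import Function.Base using (_∘_; id)
open import Function.Bundles using (_⇔_; mk⇔; Equivalence)
open import Level using (Level; 0ℓ)
open import Relation.Binary.Core using (REL)
open import Relation.Binary.Definitions
  using (DecidableEquality) renaming (Decidable to Decidable₂)
open import Relation.Binary.PropositionalEquality
  using (_≡_; _≢_; refl; sym; trans; cong; subst; subst₂; setoid)
open import Relation.Nullary.Decidable
  using (Dec; yes; no; ¬?; _×-dec_; map′; recompute; does)
open import Relation.Nullary.Negation using (¬_; contradiction)
open import Relation.Unary
  using (Pred; Decidable; ∁; _∪_; _∩_; ∅; _⊆_) renaming (_∈_ to _∈ᵖ_)
open import Relation.Unary.Properties using (_∪?_; _∩?_; ∁?; ∅?)
open import Defs

private variable
  a b p q r i : Level
  A : Set a
  B : Set b

-- Counting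

count : {P : Pred A p} → Decidable P → List A → ℕ
count P? xs = length (filter P? xs)

module _ {P : Pred A p} (P? : Decidable P) where

  count-accept : ∀ {x xs} → P x → count P? (x ∷ xs) ≡ suc (count P? xs)
  count-accept Px = cong length (filter-accept P? Px)

  count-reject : ∀ {x xs} → ¬ P x → count P? (x ∷ xs) ≡ count P? xs
  count-reject ¬Px = cong length (filter-reject P? ¬Px)

  count-≤-∷ : ∀ x xs → count P? xs ≤ count P? (x ∷ xs)
  count-≤-∷ x xs with P? x
  ... | yes _ = ℕ.n≤1+n _
  ... | no  _ = ℕ.≤-refl

  count-∷-≤ : ∀ x xs → count P? (x ∷ xs) ≤ suc (count P? xs)
  count-∷-≤ x xs with P? x
  ... | yes _ = ℕ.≤-refl
  ... | no  _ = ℕ.n≤1+n _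

  count-↭ : ∀ {xs ys} → xs ↭ ys → count P? xs ≡ count P? ys
  count-↭ = ↭-length ∘ filter-↭ P?

  count-none : ∀ xs → (∀ {x} → x ∈ xs → ¬ P x) → count P? xs ≡ 0
  count-none []       none = refl
  count-none (x ∷ xs) none =
    trans (count-reject (none (here refl))) (count-none xs (none ∘ there))

module _ {P : Pred A p} {Q : Pred A q} (P? : Decidable P) (Q? : Decidable Q) where

  count-mono : ∀ xs → (∀ {x} → x ∈ xs → P x → Q x) → count P? xs ≤ count Q? xs
  count-mono []       P⊆Q = z≤n
  count-mono (x ∷ xs) P⊆Q with P? x | Q? x
  ... | yes _  | yes _  = s≤s (count-mono xs (P⊆Q ∘ there))
  ... | yes Px | no ¬Qx = contradiction (P⊆Q (here refl) Px) ¬Qx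
  ... | no  _  | yes _  = ℕ.m≤n⇒m≤1+n (count-mono xs (P⊆Q ∘ there))
  ... | no  _  | no  _  = count-mono xs (P⊆Q ∘ there)

  count-∪-∩ : ∀ xs → count (P? ∪? Q?) xs + count (P? ∩? Q?) xs ≡ count P? xs + count Q? xs
  count-∪-∩ []       = refl
  count-∪-∩ (x ∷ xs) with P? x | Q? x
  ... | yes _ | yes _ =
    cong suc (trans (ℕ.+-suc _ _) (trans (cong suc (count-∪-∩ xs)) (sym (ℕ.+-suc _ _))))
  ... | yes _ | no  _ = cong suc (count-∪-∩ xs)
  ... | no  _ | yes _ = trans (cong suc (count-∪-∩ xs)) (sym (ℕ.+-suc _ _))
  ... | no  _ | no  _ = count-∪-∩ xs

count-∖ : {P : Pred A p} {Q : Pred A q} (P? : Decidable P) (Q? : Decidable Q) →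
  ∀ xs → (∀ {x} → P x → Q x) → count Q? xs ≡ count P? xs + count (Q? ∩? ∁? P?) xs
count-∖ P? Q? []       P⊆Q = refl
count-∖ P? Q? (x ∷ xs) P⊆Q with P? x | Q? x
... | yes _  | yes _  = cong suc (count-∖ P? Q? xs P⊆Q)
... | yes Px | no ¬Qx = contradiction (P⊆Q Px) ¬Qx
... | no  _  | yes _  = trans (cong suc (count-∖ P? Q? xs P⊆Q)) (sym (ℕ.+-suc _ _))
... | no  _  | no  _  = count-∖ P? Q? xs P⊆Q

count-∪-disjoint : {P : Pred A p} {Q : Pred A q} (P? : Decidable P) (Q? : Decidable Q) →
  ∀ xs → (∀ {x} → x ∈ xs → ¬ (P x × Q x)) → count (P? ∪? Q?) xs ≡ count P? xs + count Q? xs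
count-∪-disjoint P? Q? xs disjoint =
  trans (sym (ℕ.+-identityʳ _))
        (trans (cong (count (P? ∪? Q?) xs +_) (sym (count-none (P? ∩? Q?) xs disjoint)))
               (count-∪-∩ P? Q? xs))

∈⇒↭-∷ : ∀ {x : A} {xs} → x ∈ xs → ∃[ ys ] xs ↭ x ∷ ys
∈⇒↭-∷ {x = x} x∈xs with ∈-∃++ x∈xs
... | ys , zs , refl = ys ++ zs , shift x ys zs

-- The image of the head is taken out of `ys`; by injectivity the images of the tail survive in what
-- remains. A relation replaces a function because images are known only for members of `xs`.
injection⇒length-≤ : {R : REL A B r} → ∀ {xs ys} → Unique xs →
  (∀ {x} → x ∈ xs → ∃[ y ] y ∈ ys × R x y) →
  (∀ {x x′ y} → x ∈ xs → x′ ∈ xs → R x y → R x′ y → x ≡ x′) →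
  length xs ≤ length ys
injection⇒length-≤ {xs = []} _ _ _ = z≤n
injection⇒length-≤ {xs = x ∷ xs} (x≢xs ∷ xs!) image injective
  with y , y∈ys , Rxy ← image (here refl)
  with ys′ , ys↭y∷ys′ ← ∈⇒↭-∷ y∈ys =
  ℕ.≤-trans (s≤s (injection⇒length-≤ xs! image′ λ x∈ x′∈ → injective (there x∈) (there x′∈)))
            (ℕ.≤-reflexive (sym (↭-length ys↭y∷ys′)))
  where
  image′ : ∀ {x′} → x′ ∈ xs → ∃[ y′ ] y′ ∈ ys′ × _
  image′ x′∈xs with y′ , y′∈ys , Rx′y′ ← image (there x′∈xs)
    with ∈-resp-↭ ys↭y∷ys′ y′∈ys
  ... | here refl    = contradiction (injective (here refl) (there x′∈xs) Rxy Rx′y′)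
                                     (All.lookup x≢xs x′∈xs)
  ... | there y′∈ys′ = y′ , y′∈ys′ , Rx′y′

-- Lets a pair of a matching be recovered from either component, so that the lozenge through a
-- triangle is unique.
unique-map⇒injective : {f : A → B} → ∀ {xs x x′} → Unique (map f xs) →
  x ∈ xs → x′ ∈ xs → f x ≡ f x′ → x ≡ x′
unique-map⇒injective _ (here refl) (here refl) _ = refl
unique-map⇒injective {f = f} (≢fx ∷ _) (here refl) (there x′∈) eq =
  contradiction eq (All.lookup ≢fx (∈-map⁺ f x′∈))
unique-map⇒injective {f = f} (≢fx ∷ _) (there x∈) (here refl) eq =
  contradiction (sym eq) (All.lookup ≢fx (∈-map⁺ f x∈))
unique-map⇒injective (_ ∷ xs!) (there x∈) (there x′∈) eq = unique-map⇒injective xs! x∈ x′∈ eq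

-- Hall's marriage theorem

module Hall {A B : Set} (_≟_ : DecidableEquality A)
            {R : REL A B 0ℓ} (R? : Decidable₂ R) where

  Neighbour : Pred A 0ℓ → List A → Pred B 0ℓ
  Neighbour S xs y = Any (λ x → S x × R x y) xs

  neighbour? : ∀ {S} → Decidable S → ∀ xs → Decidable (Neighbour S xs)
  neighbour? S? xs y = any? (λ x → S? x ×-dec R? x y) xs

  -- Taking each partner out of `ys`, up to permutation, makes the partners distinct list entries by
  -- construction; part of `ys` may be left over.
  data Matching : List A → List B → Set where
    []      : ∀ {ys} → Matching [] ys
    matched : ∀ {x y xs ys ys′} → R x y → ys ↭ y ∷ ys′ → Matching xs ys′ → Matching (x ∷ xs) ys

  -- Under `HallCondition`, tightness amounts to equality. The decision procedure is bundled because
  -- counting needs it.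
  Deficient Tight : List A → List B → Pred A 0ℓ → Set
  Deficient xs ys S = Σ[ S? ∈ Decidable S ] count (neighbour? S? xs) ys < count S? xs
  Tight     xs ys S = Σ[ S? ∈ Decidable S ] count (neighbour? S? xs) ys ≤ count S? xs

  HallCondition : List A → List B → Set₁
  HallCondition xs ys = ∀ {S} (S? : Decidable S) → count S? xs ≤ count (neighbour? S? xs) ys

  -- Distinct members of `S` have distinct partners, all of them neighbours. In `hall` a matching of
  -- the tail thereby supplies the condition that `tight-∪` needs.
  matching⇒hallCondition : ∀ {xs ys} → Matching xs ys → HallCondition xs ys
  matching⇒hallCondition [] S? = z≤n
  matching⇒hallCondition (matched {x} {y} {xs} {ys} {ys′} Rxy ys↭ M) {S} S? = by (S? x)
    where
    open ℕ.≤-Reasoning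
    N = neighbour? S? (x ∷ xs)
    rest : count S? xs ≤ count N ys′
    rest = ℕ.≤-trans (matching⇒hallCondition M S?)
                     (count-mono (neighbour? S? xs) N ys′ λ _ → there)
    by : Dec (S x) → count S? (x ∷ xs) ≤ count N ys
    by (yes Sx) = begin
      count S? (x ∷ xs)  ≡⟨ count-accept S? Sx ⟩
      suc (count S? xs)  ≤⟨ s≤s rest ⟩
      suc (count N ys′)  ≡⟨ count-accept N (here (Sx , Rxy)) ⟨
      count N (y ∷ ys′)  ≡⟨ count-↭ N ys↭ ⟨
      count N ys         ∎
    by (no ¬Sx) = begin
      count S? (x ∷ xs)  ≡⟨ count-reject S? ¬Sx ⟩
      count S? xs        ≤⟨ rest ⟩
      count N ys′        ≤⟨ count-≤-∷ N y ys′ ⟩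
      count N (y ∷ ys′)  ≡⟨ count-↭ N ys↭ ⟨
      count N ys         ∎

  -- Neighbourhood size is submodular.
  tight-∪ : ∀ {xs ys S S′} → HallCondition xs ys →
            Tight xs ys S → Tight xs ys S′ → Tight xs ys (S ∪ S′)
  tight-∪ {xs} {ys} condition (S? , tight) (S′? , tight′) =
    S? ∪? S′? , ℕ.+-cancelʳ-≤ (count (S? ∩? S′?) xs) _ _ (begin
      count (neighbour? (S? ∪? S′?) xs) ys + count (S? ∩? S′?) xs
        ≤⟨ ℕ.+-mono-≤ (count-mono _ (N? ∪? N′?) ys λ _ → split)
             (ℕ.≤-trans (condition (S? ∩? S′?)) (count-mono _ (N? ∩? N′?) ys λ _ → both)) ⟩
      count (N? ∪? N′?) ys + count (N? ∩? N′?) ys            ≡⟨ count-∪-∩ N? N′? ys ⟩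
      count N? ys + count N′? ys                            ≤⟨ ℕ.+-mono-≤ tight tight′ ⟩
      count S? xs + count S′? xs                            ≡⟨ count-∪-∩ S? S′? xs ⟨
      count (S? ∪? S′?) xs + count (S? ∩? S′?) xs            ∎)
    where
    open ℕ.≤-Reasoning
    N?  = neighbour? S? xs
    N′? = neighbour? S′? xs
    split : ∀ {S S′ xs y} → Neighbour (S ∪ S′) xs y → (Neighbour S xs ∪ Neighbour S′ xs) y
    split (here (inj₁ Sx , Rxy))  = inj₁ (here (Sx , Rxy))
    split (here (inj₂ S′x , Rxy)) = inj₂ (here (S′x , Rxy))
    split (there n) = [ inj₁ ∘ there , inj₂ ∘ there ] (split n)
    both : ∀ {S S′ xs y} → Neighbour (S ∩ S′) xs y → (Neighbour S xs ∩ Neighbour S′ xs) y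
    both n = Any.map (λ ((Sx , _) , Rxy) → Sx , Rxy) n , Any.map (λ ((_ , S′x) , Rxy) → S′x , Rxy) n

  -- Removing `y` costs at most one neighbour, so a set deficient afterwards was tight before.
  -- Hall's condition held before, so a neighbour was indeed lost, and it can only be `y`.
  deficient-∷⇒tight : ∀ {xs ys y ys′ S} → HallCondition xs ys → ys ↭ y ∷ ys′ →
                      Deficient xs ys′ S → Tight xs ys S × Neighbour S xs y
  deficient-∷⇒tight {xs} {ys} {y} {ys′} {S} condition ys↭ (S? , deficient) =
    (S? , tight) , adjacent (N? y)
    where
    N? = neighbour? S? xs
    tight : count N? ys ≤ count S? xs
    tight = ℕ.≤-trans (ℕ.≤-reflexive (count-↭ N? ys↭))
              (ℕ.≤-trans (count-∷-≤ N? y ys′) deficient)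
    adjacent : Dec (Neighbour S xs y) → Neighbour S xs y
    adjacent (yes n) = n
    adjacent (no ¬n) = contradiction
      (ℕ.≤-<-trans (condition S?)
        (ℕ.≤-<-trans (ℕ.≤-reflexive (trans (count-↭ N? ys↭) (count-reject N? ¬n))) deficient))
      (ℕ.<-irrefl refl)

  -- Each candidate `z` is tried as partner of `x`, with `hall-xs` rematching `xs` in the rest. A
  -- failure yields a tight set with `z` as a neighbour. The union of these sets, starting from the
  -- empty one, stays tight and reaches every candidate.
  extend-or-tight : ∀ {xs ys} x → HallCondition xs ys →
    (∀ ys → Matching xs ys ⊎ ∃ (Deficient xs ys)) →
    ∀ zs → (∀ {z} → z ∈ zs → z ∈ ys) →
    Matching (x ∷ xs) ys ⊎
    (∃[ S ] Tight xs ys S × (∀ {z} → z ∈ zs → R x z → Neighbour S xs z))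
  extend-or-tight {xs} {ys} x condition hall-xs [] _ =
    inj₂ (∅ , (∅? , ℕ.≤-trans (ℕ.≤-reflexive (count-none (neighbour? ∅? xs) ys λ _ → none)) z≤n) , λ ())
    where
    none : ∀ {xs y} → ¬ Neighbour ∅ xs y
    none (here (() , _))
    none (there n) = none n
  extend-or-tight {xs} {ys} x condition hall-xs (z ∷ zs) zs⊆ys
    with extend-or-tight x condition hall-xs zs (zs⊆ys ∘ there)
  ... | inj₁ M = inj₁ M
  ... | inj₂ (S , tight , covers) with R? x z
  ...   | no ¬Rxz = inj₂ (S , tight , λ
            { (here refl) Rxz → contradiction Rxz ¬Rxz ; (there z∈zs) → covers z∈zs })
  ...   | yes Rxz with ys′ , ys↭ ← ∈⇒↭-∷ (zs⊆ys (here refl)) with hall-xs ys′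
  ...     | inj₁ M = inj₁ (matched Rxz ys↭ M)
  ...     | inj₂ (S′ , deficient)
            with tight′ , adjacent ← deficient-∷⇒tight condition ys↭ deficient =
            inj₂ (S ∪ S′ , tight-∪ {xs} {ys} condition tight tight′ , λ
              { (here refl) _    → Any.map (λ (S′x , r) → inj₂ S′x , r) adjacent
              ; (there z∈zs) Rxz → Any.map (λ (Sx , r) → inj₁ Sx , r) (covers z∈zs Rxz) })

  -- Induction on `xs`. When the tail is matched but `x` cannot be added, there is a tight set whose
  -- neighbours include all those of `x`. Adjoining `x` enlarges this set without new neighbours,
  -- which makes it deficient.
  hall : ∀ {xs} → Unique xs → ∀ ys → Matching xs ys ⊎ ∃ (Deficient xs ys)
  hall {[]} _ ys = inj₁ []
  hall {x ∷ xs} (x≢xs ∷ xs!) ys with hall xs! ys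
  -- `S` is an arbitrary predicate and may hold of `x`; excluding `x` keeps its neighbours out of
  -- the count.
  ... | inj₂ (S , S? , deficient) = inj₂ (S∖x , S∖x? , (begin-strict
      count (neighbour? S∖x? (x ∷ xs)) ys  ≤⟨ count-mono _ (neighbour? S? xs) ys (λ _ → drop) ⟩
      count (neighbour? S? xs) ys          <⟨ deficient ⟩
      count S? xs                          ≤⟨ count-mono S? S∖x? xs keep ⟩
      count S∖x? xs                        ≤⟨ count-≤-∷ S∖x? x xs ⟩
      count S∖x? (x ∷ xs)                  ∎))
    where
    open ℕ.≤-Reasoning
    S∖x : Pred A 0ℓ
    S∖x = S ∩ (_≢ x)
    S∖x? : Decidable S∖x
    S∖x? = S? ∩? λ y → ¬? (y ≟ x)
    keep : ∀ {y} → y ∈ xs → S y → S∖x y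
    keep y∈xs Sy = Sy , All.lookup x≢xs y∈xs ∘ sym
    drop : ∀ {z} → Neighbour S∖x (x ∷ xs) z → Neighbour S xs z
    drop (here ((_ , x≢x) , _)) = contradiction refl x≢x
    drop (there n) = Any.map (λ ((Sy , _) , r) → Sy , r) n
  ... | inj₁ M with extend-or-tight x (matching⇒hallCondition M) (hall xs!) ys id
  ...   | inj₁ M′ = inj₁ M′
  ...   | inj₂ (S , (S? , tight) , covers) = inj₂ (S∪x , S∪x? , (begin-strict
      count (neighbour? S∪x? (x ∷ xs)) ys  ≤⟨ count-mono _ (neighbour? S? xs) ys absorb ⟩
      count (neighbour? S? xs) ys          ≤⟨ tight ⟩
      count S? xs                          ≤⟨ count-mono S? S∪x? xs (λ _ → inj₁) ⟩
      count S∪x? xs                        <⟨ ℕ.n<1+n _ ⟩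
      suc (count S∪x? xs)                  ≡⟨ count-accept S∪x? (inj₂ refl) ⟨
      count S∪x? (x ∷ xs)                  ∎))
    where
    open ℕ.≤-Reasoning
    S∪x : Pred A 0ℓ
    S∪x = S ∪ (_≡ x)
    S∪x? : Decidable S∪x
    S∪x? = S? ∪? (_≟ x)
    absorb : ∀ {z} → z ∈ ys → Neighbour S∪x (x ∷ xs) z → Neighbour S xs z
    absorb z∈ys (here (_ , Rxz)) = covers z∈ys Rxz
    absorb z∈ys (there n) with find n
    ... | y , y∈xs , inj₁ Sy , Ryz   = lose y∈xs (Sy , Ryz)
    ... | y , y∈xs , inj₂ refl , Rxz = covers z∈ys Rxz

  -- Equal lengths leave nothing of `ys` over, so the pairs exhaust both sides; they become the
  -- lozenges.
  perfect : ∀ {xs ys} → Matching xs ys → length xs ≡ length ys →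
    ∃[ ps ] map proj₁ ps ≡ xs × (∀ {x y} → (x , y) ∈ ps → R x y) × ys ↭ map proj₂ ps
  perfect {ys = []} [] _ = [] , refl , (λ ()) , ↭-refl
  perfect (matched {x} {y} Rxy ys↭ M) eq
    with ps , refl , related , ys′↭ ← perfect M (ℕ.suc-injective (trans eq (↭-length ys↭))) =
    (x , y) ∷ ps , refl , (λ { (here refl) → Rxy ; (there p∈ps) → related p∈ps }) ,
    ↭-trans ys↭ (prep y ys′↭)

-- Monomials

∣ᵐ⇒≤ : ∀ {p m} → p ∣ᵐ m → xᵉ p ≤ xᵉ m × yᵉ p ≤ yᵉ m × zᵉ p ≤ zᵉ m
∣ᵐ⇒≤ (q , refl) = ℕ.m≤n+m _ (xᵉ q) , ℕ.m≤n+m _ (yᵉ q) , ℕ.m≤n+m _ (zᵉ q)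

≤⇒∣ᵐ : ∀ {p m} → xᵉ p ≤ xᵉ m → yᵉ p ≤ yᵉ m → zᵉ p ≤ zᵉ m → p ∣ᵐ m
≤⇒∣ᵐ {x^ a y^ b z^ c} {x^ a′ y^ b′ z^ c′} a≤ b≤ c≤ =
  x^ (a′ ∸ a) y^ (b′ ∸ b) z^ (c′ ∸ c) ,
  monomial-≡ (sym (ℕ.m∸n+n≡m a≤)) (sym (ℕ.m∸n+n≡m b≤)) (sym (ℕ.m∸n+n≡m c≤))
  where
  monomial-≡ : ∀ {a a′ b b′ c c′} → a ≡ a′ → b ≡ b′ → c ≡ c′ →
               x^ a y^ b z^ c ≡ x^ a′ y^ b′ z^ c′
  monomial-≡ refl refl refl = refl

infix 4 _∣ᵐ?_
_∣ᵐ?_ : Decidable₂ _∣ᵐ_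
p ∣ᵐ? m = map′ (λ (a≤ , b≤ , c≤) → ≤⇒∣ᵐ a≤ b≤ c≤) ∣ᵐ⇒≤
  (xᵉ p ℕ.≤? xᵉ m ×-dec yᵉ p ℕ.≤? yᵉ m ×-dec zᵉ p ℕ.≤? zᵉ m)

∣ᵐ-refl : ∀ {m} → m ∣ᵐ m
∣ᵐ-refl = x^ 0 y^ 0 z^ 0 , refl

∣ᵐ-trans : ∀ {p q m} → p ∣ᵐ q → q ∣ᵐ m → p ∣ᵐ m
∣ᵐ-trans p∣q q∣m with a≤ , b≤ , c≤ ← ∣ᵐ⇒≤ p∣q | a≤′ , b≤′ , c≤′ ← ∣ᵐ⇒≤ q∣m =
  ≤⇒∣ᵐ (ℕ.≤-trans a≤ a≤′) (ℕ.≤-trans b≤ b≤′) (ℕ.≤-trans c≤ c≤′)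

∤ᵐ⇒> : ∀ {p m} → ¬ (p ∣ᵐ m) → xᵉ m < xᵉ p ⊎ yᵉ m < yᵉ p ⊎ zᵉ m < zᵉ p
∤ᵐ⇒> {p} {m} p∤m with xᵉ p ℕ.≤? xᵉ m | yᵉ p ℕ.≤? yᵉ m | zᵉ p ℕ.≤? zᵉ m
... | no a≰  | _      | _      = inj₁ (ℕ.≰⇒> a≰)
... | yes _  | no b≰  | _      = inj₂ (inj₁ (ℕ.≰⇒> b≰))
... | yes _  | yes _  | no c≰  = inj₂ (inj₂ (ℕ.≰⇒> c≰))
... | yes a≤ | yes b≤ | yes c≤ = contradiction (≤⇒∣ᵐ a≤ b≤ c≤) p∤m

degree-mono : ∀ {p m} → p ∣ᵐ m → degree p ≤ degree m
degree-mono p∣m with a≤ , b≤ , c≤ ← ∣ᵐ⇒≤ p∣m = ℕ.+-mono-≤ (ℕ.+-mono-≤ a≤ b≤) c≤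

gcdᵐ : Monomial → Monomial → Monomial
gcdᵐ p q = x^ (xᵉ p ⊓ xᵉ q) y^ (yᵉ p ⊓ yᵉ q) z^ (zᵉ p ⊓ zᵉ q)

gcdᵐ∣ˡ : ∀ p q → gcdᵐ p q ∣ᵐ p
gcdᵐ∣ˡ p q = ≤⇒∣ᵐ (ℕ.m⊓n≤m _ _) (ℕ.m⊓n≤m _ _) (ℕ.m⊓n≤m _ _)

gcdᵐ∣ʳ : ∀ p q → gcdᵐ p q ∣ᵐ q
gcdᵐ∣ʳ p q = ≤⇒∣ᵐ (ℕ.m⊓n≤n (xᵉ p) _) (ℕ.m⊓n≤n (yᵉ p) _) (ℕ.m⊓n≤n (zᵉ p) _)

sharesEdge⇒∣ᵐ : ∀ {n m} → SharesEdge n m → n ∣ᵐ m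
sharesEdge⇒∣ᵐ (inj₁ m≡)        = x , m≡
sharesEdge⇒∣ᵐ (inj₂ (inj₁ m≡)) = y , m≡
sharesEdge⇒∣ᵐ (inj₂ (inj₂ m≡)) = z , m≡

sharesEdge⇒degree : ∀ {n m} → SharesEdge n m → degree m ≡ suc (degree n)
sharesEdge⇒degree (inj₁ refl)            = refl
sharesEdge⇒degree {n} (inj₂ (inj₁ refl)) = cong (_+ zᵉ n) (ℕ.+-suc (xᵉ n) (yᵉ n))
sharesEdge⇒degree {n} (inj₂ (inj₂ refl)) = ℕ.+-suc (xᵉ n + yᵉ n) (zᵉ n)

-- The cofactor has degree one, hence is a variable. Matchings can therefore use decidable
-- divisibility as adjacency.
∣ᵐ⇒sharesEdge : ∀ {n m} → n ∣ᵐ m → degree m ≡ suc (degree n) → SharesEdge n m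
∣ᵐ⇒sharesEdge {n} (q , refl) deg =
  by q (ℕ.+-cancelʳ-≡ (degree n) _ 1 (trans (sym (degree-· q n)) deg))
  where
  degree-· : ∀ q n → degree (q · n) ≡ degree q + degree n
  degree-· (x^ a y^ b z^ c) (x^ a′ y^ b′ z^ c′) = solve 6
    (λ a b c a′ b′ c′ → a :+ a′ :+ (b :+ b′) :+ (c :+ c′) := a :+ b :+ c :+ (a′ :+ b′ :+ c′))
    refl a b c a′ b′ c′
    where open +-*-Solver
  by : ∀ q → degree q ≡ 1 → SharesEdge n (q · n)
  by (x^ 1 y^ 0 z^ 0) _ = inj₁ refl
  by (x^ 0 y^ 1 z^ 0) _ = inj₂ (inj₁ refl)
  by (x^ 0 y^ 0 z^ 1) _ = inj₂ (inj₂ refl)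

-- Merging overlapping triangles

-- The third coordinate of n is compared with that of m₀ so that n alone
-- determines which variable was removed from m.
Step : Monomial → Monomial → Monomial → Set
Step m₀ m n =
    (m ≡ x · n × xᵉ m₀ ≤ xᵉ n × yᵉ n < yᵉ m₀ × zᵉ n < zᵉ m₀)
  ⊎ (m ≡ y · n × xᵉ n < xᵉ m₀ × yᵉ m₀ ≤ yᵉ n × zᵉ n < zᵉ m₀)
  ⊎ (m ≡ z · n × xᵉ n < xᵉ m₀ × yᵉ n < yᵉ m₀ × zᵉ m₀ ≤ zᵉ n)

step⇒sharesEdge : ∀ {m₀ m n} → Step m₀ m n → SharesEdge n m
step⇒sharesEdge (inj₁ (m≡ , _))        = inj₁ m≡
step⇒sharesEdge (inj₂ (inj₁ (m≡ , _))) = inj₂ (inj₁ m≡)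
step⇒sharesEdge (inj₂ (inj₂ (m≡ , _))) = inj₂ (inj₂ m≡)

-- Within one case `n` fixes `m`. Two different cases disagree on which coordinate of `n` reaches
-- that of `m₀`.
step-injective : ∀ {m₀ m m′ n} → Step m₀ m n → Step m₀ m′ n → m ≡ m′
step-injective (inj₁ (refl , _)) (inj₁ (refl , _)) = refl
step-injective (inj₂ (inj₁ (refl , _))) (inj₂ (inj₁ (refl , _))) = refl
step-injective (inj₂ (inj₂ (refl , _))) (inj₂ (inj₂ (refl , _))) = refl
step-injective (inj₁ (_ , ≤x , _)) (inj₂ (inj₁ (_ , x< , _))) = contradiction x< (ℕ.≤⇒≯ ≤x)
step-injective (inj₁ (_ , ≤x , _)) (inj₂ (inj₂ (_ , x< , _))) = contradiction x< (ℕ.≤⇒≯ ≤x)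
step-injective (inj₂ (inj₁ (_ , x< , _))) (inj₁ (_ , ≤x , _)) = contradiction x< (ℕ.≤⇒≯ ≤x)
step-injective (inj₂ (inj₁ (_ , _ , ≤y , _))) (inj₂ (inj₂ (_ , _ , y< , _))) =
  contradiction y< (ℕ.≤⇒≯ ≤y)
step-injective (inj₂ (inj₂ (_ , x< , _))) (inj₁ (_ , ≤x , _)) = contradiction x< (ℕ.≤⇒≯ ≤x)
step-injective (inj₂ (inj₂ (_ , _ , y< , _))) (inj₂ (inj₁ (_ , _ , ≤y , _))) =
  contradiction y< (ℕ.≤⇒≯ ≤y)

module _ {g m₀ m} (g∣m₀ : g ∣ᵐ m₀) (g∣m : g ∣ᵐ m) (deg : degree m ≡ degree m₀) where

  private
    gₓ≤  = proj₁ (∣ᵐ⇒≤ g∣m)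
    g_y≤ = proj₁ (proj₂ (∣ᵐ⇒≤ g∣m))
    g_z≤ = proj₂ (proj₂ (∣ᵐ⇒≤ g∣m))

  -- If `xᵉ m` were at most `xᵉ m₀`, the degree of `m` would be too small. So `xᵉ m` is a successor,
  -- and its predecessor is still at least `xᵉ m₀`, hence at least `xᵉ g`.
  x-step : yᵉ m < yᵉ m₀ → zᵉ m < zᵉ m₀ → ∃[ n ] Step m₀ m n × g ∣ᵐ n
  x-step y< z< with xᵉ m in eq
    | ℕ.≰⇒> {xᵉ m} {xᵉ m₀} (λ ≤x → ℕ.<⇒≢ (ℕ.+-mono-< (ℕ.+-mono-≤-< ≤x y<) z<) deg)
  ... | suc a | s≤s x≤ = x^ a y^ yᵉ m z^ zᵉ m ,
    inj₁ (cong (λ a → x^ a y^ yᵉ m z^ zᵉ m) eq , x≤ , y< , z<) ,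
    ≤⇒∣ᵐ (ℕ.≤-trans (proj₁ (∣ᵐ⇒≤ g∣m₀)) x≤) g_y≤ g_z≤

  y-step : xᵉ m < xᵉ m₀ → zᵉ m < zᵉ m₀ → ∃[ n ] Step m₀ m n × g ∣ᵐ n
  y-step x< z< with yᵉ m in eq
    | ℕ.≰⇒> {yᵉ m} {yᵉ m₀} (λ ≤y → ℕ.<⇒≢ (ℕ.+-mono-< (ℕ.+-mono-<-≤ x< ≤y) z<) deg)
  ... | suc b | s≤s y≤ = x^ xᵉ m y^ b z^ zᵉ m ,
    inj₂ (inj₁ (cong (λ b → x^ xᵉ m y^ b z^ zᵉ m) eq , x< , y≤ , z<)) ,
    ≤⇒∣ᵐ gₓ≤ (ℕ.≤-trans (proj₁ (proj₂ (∣ᵐ⇒≤ g∣m₀))) y≤) g_z≤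

  z-step : xᵉ m < xᵉ m₀ → yᵉ m < yᵉ m₀ → ∃[ n ] Step m₀ m n × g ∣ᵐ n
  z-step x< y< with zᵉ m in eq
    | ℕ.≰⇒> {zᵉ m} {zᵉ m₀} (λ ≤z → ℕ.<⇒≢ (ℕ.+-mono-<-≤ (ℕ.+-mono-< x< y<) ≤z) deg)
  ... | suc c | s≤s z≤ = x^ xᵉ m y^ yᵉ m z^ c ,
    inj₂ (inj₂ (cong (λ c → x^ xᵉ m y^ yᵉ m z^ c) eq , x< , y< , z≤)) ,
    ≤⇒∣ᵐ gₓ≤ g_y≤ (ℕ.≤-trans (proj₂ (proj₂ (∣ᵐ⇒≤ g∣m₀))) z≤)

-- Non-divisibility puts `m` below `p` in one coordinate and below `q` in one. These coordinates
-- differ, and `m₀` dominates both `p` and `q`, so `m` is below `m₀` in two coordinates and the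
-- third can be lowered.
gcdᵐ-step : ∀ {p q m₀ m} → p ∣ᵐ m₀ → q ∣ᵐ m₀ → degree m ≡ degree m₀ →
  gcdᵐ p q ∣ᵐ m → ¬ (p ∣ᵐ m) → ¬ (q ∣ᵐ m) → ∃[ n ] Step m₀ m n × gcdᵐ p q ∣ᵐ n
gcdᵐ-step {p} {q} {m₀} {m} p∣m₀ q∣m₀ deg g∣m p∤m q∤m
  with g∣m₀ ← ∣ᵐ-trans (gcdᵐ∣ˡ p q) p∣m₀
     | px , py , pz ← ∣ᵐ⇒≤ p∣m₀ | qx , qy , qz ← ∣ᵐ⇒≤ q∣m₀ | gx , gy , gz ← ∣ᵐ⇒≤ g∣m
  with ∤ᵐ⇒> p∤m | ∤ᵐ⇒> q∤m
-- In a common coordinate `m` would lie below the minimum, against divisibility by the gcd.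
... | inj₁ x<p        | inj₁ x<q        = contradiction (ℕ.⊓-pres-m< x<p x<q) (ℕ.≤⇒≯ gx)
... | inj₂ (inj₁ y<p) | inj₂ (inj₁ y<q) = contradiction (ℕ.⊓-pres-m< y<p y<q) (ℕ.≤⇒≯ gy)
... | inj₂ (inj₂ z<p) | inj₂ (inj₂ z<q) = contradiction (ℕ.⊓-pres-m< z<p z<q) (ℕ.≤⇒≯ gz)
... | inj₁ x<p        | inj₂ (inj₁ y<q) =
      z-step g∣m₀ g∣m deg (ℕ.<-≤-trans x<p px) (ℕ.<-≤-trans y<q qy)
... | inj₂ (inj₁ y<p) | inj₁ x<q        =
      z-step g∣m₀ g∣m deg (ℕ.<-≤-trans x<q qx) (ℕ.<-≤-trans y<p py)
... | inj₁ x<p        | inj₂ (inj₂ z<q) =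
      y-step g∣m₀ g∣m deg (ℕ.<-≤-trans x<p px) (ℕ.<-≤-trans z<q qz)
... | inj₂ (inj₂ z<p) | inj₁ x<q        =
      y-step g∣m₀ g∣m deg (ℕ.<-≤-trans x<q qx) (ℕ.<-≤-trans z<p pz)
... | inj₂ (inj₁ y<p) | inj₂ (inj₂ z<q) =
      x-step g∣m₀ g∣m deg (ℕ.<-≤-trans y<p py) (ℕ.<-≤-trans z<q qz)
... | inj₂ (inj₂ z<p) | inj₂ (inj₁ y<q) =
      x-step g∣m₀ g∣m deg (ℕ.<-≤-trans y<q qy) (ℕ.<-≤-trans z<p pz)

MultipleOf : List Monomial → Pred Monomial 0ℓ
MultipleOf ps m = Any (_∣ᵐ m) ps

multipleOf? : ∀ ps → Decidable (MultipleOf ps)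
multipleOf? ps m = any? (_∣ᵐ? m) ps

multipleOf-∣ᵐ : ∀ {ps n m} → MultipleOf ps n → n ∣ᵐ m → MultipleOf ps m
multipleOf-∣ᵐ ps∣n n∣m = Any.map (λ p∣n → ∣ᵐ-trans p∣n n∣m) ps∣n

-- The region enters through its downward labels `ds` and upward labels `us`. The ideal property
-- enters as `divisor-closed`: a divisor of a monomial outside the ideal is outside too.
module LightRegion {ds us : List Monomial} (us! : Unique us)
  (homogeneous : ∀ {m m′} → m ∈ us → m′ ∈ us → degree m ≡ degree m′)
  (divisor-closed : ∀ {n m} → m ∈ us → SharesEdge n m → n ∈ ds)
  (light : ∀ p → count (p ∣ᵐ?_) ds ≤ count (p ∣ᵐ?_) us)
  where

  private
    Light : List Monomial → Set
    Light ps = count (multipleOf? ps) ds ≤ count (multipleOf? ps) us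

  -- On the downward side the count of a union is at most the sum of the counts; on the upward side
  -- disjointness gives equality.
  light-disjoint : ∀ p ps → Light ps → (∀ {m} → m ∈ us → ¬ (p ∣ᵐ m × MultipleOf ps m)) →
                   Light (p ∷ ps)
  light-disjoint p ps light-ps disjoint = begin
    count (multipleOf? (p ∷ ps)) ds                       ≤⟨ count-mono _ (p? ∪? ps?) ds (λ _ → Any.toSum) ⟩
    count (p? ∪? ps?) ds                                  ≤⟨ ℕ.m≤m+n _ _ ⟩
    count (p? ∪? ps?) ds + count (p? ∩? ps?) ds           ≡⟨ count-∪-∩ p? ps? ds ⟩
    count p? ds + count ps? ds                            ≤⟨ ℕ.+-mono-≤ (light p) light-ps ⟩
    count p? us + count ps? us                            ≡⟨ count-∪-disjoint p? ps? us disjoint ⟨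
    count (p? ∪? ps?) us                                  ≤⟨ count-mono _ (multipleOf? (p ∷ ps)) us (λ _ → Any.fromSum) ⟩
    count (multipleOf? (p ∷ ps)) us                       ∎
    where
    open ℕ.≤-Reasoning
    p?  = p ∣ᵐ?_
    ps? = multipleOf? ps

  -- Merging adds exactly the labels in `New?`, among which there are at least as many downward as
  -- upward ones. Cancelling them carries lightness from the merged union back to the old one.
  light-merge : ∀ p q ps {ps′ m₀} → ps ↭ q ∷ ps′ → m₀ ∈ us → p ∣ᵐ m₀ → q ∣ᵐ m₀ →
                Light (gcdᵐ p q ∷ ps′) → Light (p ∷ ps)
  light-merge p q ps {ps′} {m₀} ps↭ m₀∈us p∣m₀ q∣m₀ light-gcd =
    ℕ.+-cancelʳ-≤ (count New? ds) _ _ (begin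
      count Old? ds + count New? ds      ≡⟨ count-∖ Old? All? ds old⇒all ⟨
      count All? ds                      ≤⟨ light-gcd ⟩
      count All? us                      ≡⟨ count-∖ Old? All? us old⇒all ⟩
      count Old? us + count New? us      ≤⟨ ℕ.+-monoʳ-≤ (count Old? us) new-≤ ⟩
      count Old? us + count New? ds      ∎)
    where
    open ℕ.≤-Reasoning
    Old? = multipleOf? (p ∷ ps)
    All? = multipleOf? (gcdᵐ p q ∷ ps′)
    New? = All? ∩? ∁? Old?
    old⇒all : ∀ {m} → MultipleOf (p ∷ ps) m → MultipleOf (gcdᵐ p q ∷ ps′) m
    old⇒all (here p∣m) = here (∣ᵐ-trans (gcdᵐ∣ˡ p q) p∣m)
    old⇒all (there ps∣m) with Any-resp-↭ ps↭ ps∣m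
    ... | here q∣m     = here (∣ᵐ-trans (gcdᵐ∣ʳ p q) q∣m)
    ... | there ps′∣m  = there ps′∣m
    ps∣ : ∀ {m} → MultipleOf (q ∷ ps′) m → MultipleOf (p ∷ ps) m
    ps∣ = there ∘ Any-resp-↭ (↭-sym ps↭)
    image : ∀ {m} → m ∈ filter New? us → ∃[ n ] n ∈ filter New? ds × Step m₀ m n
    image m∈ with ∈-filter⁻ New? {xs = us} m∈
    -- Multiples of `ps′` are old already, so only the gcd contributes new labels.
    ... | m∈us , there ps′∣m , ¬old = contradiction (ps∣ (there ps′∣m)) ¬old
    ... | m∈us , here g∣m    , ¬old
      with n , step , g∣n ← gcdᵐ-step p∣m₀ q∣m₀ (homogeneous m∈us m₀∈us) g∣m
                                      (¬old ∘ here) (¬old ∘ ps∣ ∘ here) =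
      -- `n` is new as well: if it were old, so would be its multiple `m`.
      n , ∈-filter⁺ New? (divisor-closed m∈us (step⇒sharesEdge step))
            (here g∣n , λ old → ¬old (multipleOf-∣ᵐ old (sharesEdge⇒∣ᵐ (step⇒sharesEdge step)))) , step
    new-≤ : count New? us ≤ count New? ds
    new-≤ = injection⇒length-≤ (filter⁺ New? us!) image λ _ _ → step-injective

  -- Recursion on a bound `k` for the length, since merging does not pass to a sublist: it replaces
  -- `p` and `q` by their gcd, leaving a list as long as `ps`.
  light-multiples : ∀ k ps → length ps ≤ k → Light ps
  light-multiples k [] _ = ℕ.≤-trans (ℕ.≤-reflexive (count-none (multipleOf? []) ds λ _ ())) z≤n
  light-multiples (suc k) (p ∷ ps) (s≤s length≤k)
    -- Looks for a `q` having a common multiple with `p` among the upward labels.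
    with any? (λ q → any? (λ m → p ∣ᵐ? m ×-dec q ∣ᵐ? m) us) ps
  ... | no separate = light-disjoint p ps (light-multiples k ps length≤k)
          λ m∈us (p∣m , ps∣m) → let q , q∈ps , q∣m = find ps∣m in
            separate (lose q∈ps (lose m∈us (p∣m , q∣m)))
  ... | yes meet
          with q , q∈ps , common ← find meet
          with m₀ , m₀∈us , p∣m₀ , q∣m₀ ← find common
          with ps′ , ps↭ ← ∈⇒↭-∷ q∈ps =
          light-merge p q ps ps↭ m₀∈us p∣m₀ q∣m₀
            (light-multiples k (gcdᵐ p q ∷ ps′) (subst (_≤ k) (↭-length ps↭) length≤k))

  open Hall _≟ᵐ_ _∣ᵐ?_

  -- The members of a deficient set that lie in `ds` generate a union of monomial triangles. It
  -- contains those members, and its upward labels are all neighbours of the set, so it would not be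
  -- light.
  light⇒matching : Unique ds → Matching ds us
  light⇒matching ds! with hall ds! us
  ... | inj₁ M = M
  ... | inj₂ (S , S? , deficient) = contradiction (begin-strict
      count (multipleOf? ps) us        ≤⟨ count-mono _ (neighbour? S? ds) us (λ _ → multiple⇒neighbour) ⟩
      count (neighbour? S? ds) us      <⟨ deficient ⟩
      count S? ds                      ≤⟨ count-mono S? (multipleOf? ps) ds S⇒multiple ⟩
      count (multipleOf? ps) ds        ∎) (ℕ.≤⇒≯ (light-multiples _ ps ℕ.≤-refl))
    where
    open ℕ.≤-Reasoning
    ps = filter S? ds
    S⇒multiple : ∀ {n} → n ∈ ds → S n → MultipleOf ps n
    S⇒multiple n∈ds Sn = lose (∈-filter⁺ S? n∈ds Sn) ∣ᵐ-refl
    multiple⇒neighbour : ∀ {m} → MultipleOf ps m → Neighbour S ds m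
    multiple⇒neighbour ps∣m with p , p∈ps , p∣m ← find ps∣m
      with p∈ds , Sp ← ∈-filter⁻ S? {xs = ds} p∈ps = lose p∈ds (Sp , p∣m)

-- Regions and the labels of their triangles

-- `c` stands for `△` or `▽`; `Oriented` then unfolds to `Upward` or `Downward`.
module _ (c : Monomial → UnitTriangle) (label-c : ∀ m → label (c m) ≡ m) where

  Oriented : Pred UnitTriangle 0ℓ
  Oriented t = ∃[ m ] t ≡ c m

  -- Carries the data of `HasSize (S ∩ Oriented) n` over to monomials, where counting and matching
  -- take place.
  record Labels (S : Region i) (n : ℕ) : Set i where
    field
      labels   : List Monomial
      unique   : Unique labels
      sound    : ∀ {m} → m ∈ labels → c m ∈ᵖ S
      complete : ∀ {m} → c m ∈ᵖ S → m ∈ labels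
      size     : length labels ≡ n

  c-injective : ∀ {m m′} → c m ≡ c m′ → m ≡ m′
  c-injective {m} {m′} eq = trans (sym (label-c m)) (trans (cong label eq) (label-c m′))

  hasSize⇒labels : ∀ {S : Region i} {n} → HasSize (S ∩ Oriented) n → Labels S n
  hasSize⇒labels {S = S} record { elements = ts ; unique = ts! ; exact = exact ; size = size } = record
    { labels   = map label ts
    ; unique   = map⁻ (subst Unique (sym ts≡) ts!)
    ; sound    = λ m∈ → proj₁ (to (exact _) (subst (_ ∈_) ts≡ (∈-map⁺ c m∈)))
    ; complete = λ cm∈S → subst (_∈ map label ts) (label-c _)
                            (∈-map⁺ label (from (exact _) (cm∈S , _ , refl)))
    ; size     = trans (length-map label ts) size
    }
    where
    open Equivalence
    -- Every listed triangle has orientation `c`, so passing to labels loses nothing and preserves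
    -- uniqueness.
    ts≡ : map c (map label ts) ≡ ts
    ts≡ = trans (sym (map-∘ ts)) (map-id-local (All.tabulate λ {t} t∈ts →
            let m , t≡cm = proj₂ (to (exact t) t∈ts) in
            trans (cong (c ∘ label) t≡cm) (trans (cong c (label-c m)) (sym t≡cm))))

  labels⇒hasSize : ∀ {S : Region i} {n} → Labels S n → HasSize (S ∩ Oriented) n
  labels⇒hasSize {S = S} ℒ = record
    { elements = map c labels
    ; unique   = map⁺ c-injective unique
    ; exact    = λ t → mk⇔
        (λ t∈ → let m , m∈ms , t≡cm = ∈-map⁻ c t∈ in
          subst (_∈ᵖ S) (sym t≡cm) (sound m∈ms) , m , t≡cm)
        (λ { (t∈S , m , refl) → ∈-map⁺ c (complete t∈S) })
    ; size     = trans (length-map c labels) size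
    }
    where open Labels ℒ

  labels-subregion : ∀ {S : Region i} {n} p (ℒ : Labels S n) →
    Labels (subregion p S) (count (p ∣ᵐ?_) (Labels.labels ℒ))
  labels-subregion p ℒ = record
    { labels   = filter (p ∣ᵐ?_) labels
    ; unique   = filter⁺ (p ∣ᵐ?_) unique
    ; sound    = λ m∈ → let m∈ms , p∣m = ∈-filter⁻ (p ∣ᵐ?_) {xs = labels} m∈ in
                   sound m∈ms , subst (p ∣ᵐ_) (sym (label-c _)) p∣m
    ; complete = λ (cm∈S , p∣) → ∈-filter⁺ (p ∣ᵐ?_) (complete cm∈S) (subst (p ∣ᵐ_) (label-c _) p∣)
    ; size     = refl
    }
    where open Labels ℒ

△Labels ▽Labels : Region i → ℕ → Set i
△Labels = Labels △ (λ _ → refl)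
▽Labels = Labels ▽ (λ _ → refl)

-- Tilings and matchings

-- The lozenge over a downward triangle of the subregion has an upward triangle whose label is a
-- multiple of the downward one, so it stays in the subregion. This assignment is injective.
tileable⇒¬▽-heavy : ∀ {S : Region i} p → Tileable S → ¬ ▽-Heavy (subregion p S)
tileable⇒¬▽-heavy {S = S} p tileable (u , v , ups , downs , u<v) =
  ℕ.<⇒≱ u<v (subst₂ _≤_ D.size U.size (downs≤ups tileable))
  where
  module U = Labels (hasSize⇒labels △ (λ _ → refl) ups)
  module D = Labels (hasSize⇒labels ▽ (λ _ → refl) downs)
  downs≤ups : Tileable S → length D.labels ≤ length U.labels
  downs≤ups (inj₁ empty) = injection⇒length-≤ {R = _≡_} {ys = U.labels} D.unique
    (λ n∈ → contradiction (proj₁ (D.sound n∈)) (empty _))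
    (λ _ _ n≡m n′≡m → trans n≡m (sym n′≡m))
  downs≤ups (inj₂ (L , tiling)) = injection⇒length-≤ {R = Tiled} D.unique image injective
    where
    open IsTiling tiling
    open Lozenge
    Tiled : Monomial → Monomial → Set
    Tiled n m = ∃[ l ] l ∈ᵖ L × down l ≡ n × up l ≡ m
    up-multiple : ∀ l → p ∣ᵐ down l → p ∣ᵐ up l
    up-multiple record { down = n ; up = m ; sharesEdge = edge } p∣n =
      -- The adjacency proof is irrelevant, but decidable divisibility can be recomputed from it.
      recompute (p ∣ᵐ? m) (∣ᵐ-trans p∣n (sharesEdge⇒∣ᵐ edge))
    image : ∀ {n} → n ∈ D.labels → ∃[ m ] m ∈ U.labels × Tiled n m
    image n∈ with ▽n∈S , p∣n ← D.sound n∈ with exactly-1 ▽n∈S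
    ... | l , (l∈L , inj₁ refl) , _ =
      up l , U.complete (contained l∈L (inj₂ refl) , up-multiple l p∣n) , l , l∈L , refl , refl
    injective : ∀ {n n′ m} → n ∈ D.labels → n′ ∈ D.labels → Tiled n m → Tiled n′ m → n ≡ n′
    injective _ _ (l , l∈L , refl , refl) (l′ , l′∈L , refl , up≡)
      -- Both lozenges contain the upward triangle of `l`, hence coincide.
      with _ , _ , unique ← exactly-1 {△ (up l)} (contained l∈L (inj₂ refl)) =
      cong down (trans (sym (unique (l∈L , inj₂ refl))) (unique (l′∈L , inj₂ (cong △ (sym up≡)))))

-- The matched pairs are the lozenges. Both label lists have size `n`, so upward triangles are
-- covered too.
matching⇒tileable : ∀ {S : Region i} {n} (D : ▽Labels S n) (U : △Labels S n) →
  (∀ {n m} → ▽ n ∈ᵖ S → △ m ∈ᵖ S → n ∣ᵐ m → SharesEdge n m) →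
  Hall.Matching _≟ᵐ_ _∣ᵐ?_ (Labels.labels D) (Labels.labels U) → Tileable S
matching⇒tileable {S = S} D U adjacent M
  with ps , downs≡ , related , ups↭ ←
    Hall.perfect _≟ᵐ_ _∣ᵐ?_ M (trans (Labels.size D) (sym (Labels.size U))) =
  inj₂ (L , record { contained = λ {l} → contained {l} ; exactly-1 = exactly-1 })
  where
  module D = Labels D
  module U = Labels U
  open Lozenge
  L : Pred Lozenge 0ℓ
  L l = (down l , up l) ∈ ps
  down∈S : ∀ {n m} → (n , m) ∈ ps → ▽ n ∈ᵖ S
  down∈S p∈ps = D.sound (subst (_ ∈_) downs≡ (∈-map⁺ proj₁ p∈ps))
  up∈S : ∀ {n m} → (n , m) ∈ ps → △ m ∈ᵖ S
  up∈S p∈ps = U.sound (∈-resp-↭ (↭-sym ups↭) (∈-map⁺ proj₂ p∈ps))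
  lozenge : ∀ {n m} → (n , m) ∈ ps → Lozenge
  lozenge {n} {m} p∈ps = record
    { down = n ; up = m ; sharesEdge = adjacent (down∈S p∈ps) (up∈S p∈ps) (related p∈ps) }
  lozenge-≡ : ∀ {l l′} → _≡_ {A = Monomial × Monomial} (down l , up l) (down l′ , up l′) → l ≡ l′
  lozenge-≡ refl = refl
  downs! : Unique (map proj₁ ps)
  downs! = subst Unique (sym downs≡) D.unique
  ups! : Unique (map proj₂ ps)
  ups! = ↭ₛ.Unique-resp-↭ (setoid Monomial) (↭⇒↭ₛ ups↭) U.unique
  contained : ∀ {l} → l ∈ᵖ L → triangles l ⊆ S
  contained l∈L (inj₁ refl) = down∈S l∈L
  contained l∈L (inj₂ refl) = up∈S l∈L
  exactly-1 : ∀ {t} → t ∈ᵖ S → ∃! _≡_ λ l → l ∈ᵖ L × t ∈ᵖ triangles l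
  exactly-1 {▽ n} t∈S with ∈-map⁻ proj₁ (subst (n ∈_) (sym downs≡) (D.complete t∈S))
  ... | (_ , m) , p∈ps , refl = lozenge p∈ps , (p∈ps , inj₁ refl) ,
    λ { (l∈L , inj₁ refl) → lozenge-≡ (unique-map⇒injective downs! p∈ps l∈L refl) }
  exactly-1 {△ m} t∈S with ∈-map⁻ proj₂ (∈-resp-↭ ups↭ (U.complete t∈S))
  ... | (n , _) , p∈ps , refl = lozenge p∈ps , (p∈ps , inj₂ refl) ,
    λ { (l∈L , inj₂ refl) → lozenge-≡ (unique-map⇒injective ups! p∈ps l∈L refl) }

-- Triangular regions of monomial ideals

module _ {k ℓ₁ ℓ₂} (K : HeytingField k ℓ₁ ℓ₂) where
  open PolynomialRing K
  private module K = HeytingField K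

  ideal-∣ᵐ : ∀ {I : Pred Polynomial i} → IsIdeal I → ∀ {n m} → n ∣ᵐ m →
             monomial n ∈ᵖ I → monomial m ∈ᵖ I
  ideal-∣ᵐ isIdeal {n} (q , refl) n∈I =
    IsIdeal.respects-≈ isIdeal product≈ (IsIdeal.*-closed isIdeal (monomial q) n∈I)
    where
    -- The product carries the coefficient `1# * 1#`, so it agrees with the monomial only up to `≈`.
    product≈ : (monomial q *ᵖ monomial n) ≈ monomial (q · n)
    product≈ m with does (q · n ≟ᵐ m)
    ... | true  = K.+-congʳ (K.*-identityˡ K.1#)
    ... | false = K.refl

theorem3p2 : ∀ {k ℓ₁ ℓ₂ i : Level} (K : HeytingField k ℓ₁ ℓ₂) →
    let open PolynomialRing K in
    (d : ℕ) → d ≥ 1 →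
    (I : Pred Polynomial i) → IsMonomialIdeal I →
    Balanced (T K d I) →
    Tileable (T K d I)
    ⇔ (¬ (∃[ p ] degree p < d × ▽-Heavy (subregion p (T K d I))))
theorem3p2 K d _ I isMonomialIdeal (n , ups , downs) = mk⇔
  (λ tileable (p , _ , heavy) → tileable⇒¬▽-heavy p tileable heavy)
  (λ ¬heavy → matching⇒tileable D U adjacent
    (LightRegion.light⇒matching U.unique homogeneous divisor-closed (light ¬heavy) D.unique))
  where
  open PolynomialRing K using (module IsMonomialIdeal)
  S = T K d I
  U : △Labels S n
  U = hasSize⇒labels △ (λ _ → refl) ups
  D : ▽Labels S n
  D = hasSize⇒labels ▽ (λ _ → refl) downs
  module U = Labels U
  module D = Labels D
  adjacent : ∀ {n m} → ▽ n ∈ᵖ S → △ m ∈ᵖ S → n ∣ᵐ m → SharesEdge n m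
  adjacent {n} (deg-n , _) (deg-m , _) n∣m = ∣ᵐ⇒sharesEdge n∣m
    (ℕ.+-cancelʳ-≡ 1 _ _ (trans deg-m (trans (sym deg-n) (ℕ.+-suc (degree n) 1))))
  homogeneous : ∀ {m m′} → m ∈ U.labels → m′ ∈ U.labels → degree m ≡ degree m′
  homogeneous m∈ m′∈ =
    ℕ.+-cancelʳ-≡ 1 _ _ (trans (proj₁ (U.sound m∈)) (sym (proj₁ (U.sound m′∈))))
  divisor-closed : ∀ {n m} → m ∈ U.labels → SharesEdge n m → n ∈ D.labels
  divisor-closed {n} m∈ edge with deg-m , m∉I ← U.sound m∈ = D.complete
    ( trans (ℕ.+-suc (degree n) 1) (trans (cong (_+ 1) (sym (sharesEdge⇒degree edge))) deg-m)
    , m∉I ∘ ideal-∣ᵐ K (IsMonomialIdeal.isIdeal isMonomialIdeal) (sharesEdge⇒∣ᵐ edge))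
  light : ¬ (∃[ p ] degree p < d × ▽-Heavy (subregion p S)) →
          ∀ p → count (p ∣ᵐ?_) D.labels ≤ count (p ∣ᵐ?_) U.labels
  light ¬heavy p with degree p ℕ.<? d
  ... | yes p<d = ℕ.≮⇒≥ λ u<v → ¬heavy
    (p , p<d , _ , _ , labels⇒hasSize △ (λ _ → refl) (labels-subregion △ (λ _ → refl) p U)
             , labels⇒hasSize ▽ (λ _ → refl) (labels-subregion ▽ (λ _ → refl) p D) , u<v)
  -- Lightness is required for every `p`; one of degree at least `d` divides no downward label, as
  -- these have degree less than `d`.
  ... | no p≮d = ℕ.≤-trans (ℕ.≤-reflexive (count-none (p ∣ᵐ?_) D.labels λ {n} n∈ p∣n →
      p≮d (ℕ.≤-<-trans (degree-mono p∣n)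
            (subst (degree n <_) (proj₁ (D.sound n∈)) (ℕ.m<m+n (degree n) (s≤s z≤n)))))) z≤n
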